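{- Let $r\ge 2$ and $\alpha\ge 1$ be integers and let $G$ be a graph with independence number $\alpha(G)=\alpha$ whose edges are colored with $r$ colors. Then $V(G)$ can be covered by the vertex sets of $r\alpha$ monochromatic connected subgraphs of $G$, each of diameter at most $2$. In other words, $g(r,2,\alpha)\le r\alpha$.
   Context: Graphs are finite and simple. A monochromatic subgraph is a subgraph (not necessarily induced) all of whose edges have the same color; a single vertex counts as a monochromatic subgraph. Different subgraphs in a cover may have different colors, and need not be disjoint or distinct. The diameter of a graph $H$ is the smallest integer $d$ with $d_H(u,v)\le d$ for all $u,v\in V(H)$, where distances are measured in $H$ itself ($\infty$ if there is no path); a one-vertex graph has diameter $0$. $g(r,d,\alpha)$ denotes the minimum $k$ such that for every graph $G$ with $\alpha(G)=\alpha$ and every coloring of the edges of $G$ with $r$ colors, $V(G)$ can be covered by the vertex sets of $k$ monochromatic subgraphs of diameter at most $d$. -}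

module Defs where

open import Data.Fin using (Fin)
open import Data.Fin.Subset using (Subset; _∈_; ∣_∣; Nonempty)
open import Data.Nat using (ℕ; zero; suc; _≤_)
open import Data.Product using (_×_; ∃-syntax)
open import Level using (0ℓ)
open import Relation.Binary using (Rel; Symmetric; Irreflexive; Decidable)
open import Relation.Binary.PropositionalEquality using (_≡_)
open import Relation.Nullary using (¬_)

IsLeast : ∀ {ℓ} → (ℕ → Set ℓ) → ℕ → Set ℓ
IsLeast P k = P k × (∀ j → P j → k ≤ j)

IsGreatest : ∀ {ℓ} → (ℕ → Set ℓ) → ℕ → Set ℓ
IsGreatest P k = P k × (∀ j → P j → j ≤ k)

record Graph : Set₁ where
  field
    order  : ℕ
    _~_    : Rel (Fin order) 0ℓ
    sym    : Symmetric _~_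
    irrefl : Irreflexive _≡_ _~_
    _~?_   : Decidable _~_

  Vertex : Set
  Vertex = Fin order

Independent : (G : Graph) → Subset (Graph.order G) → Set
Independent G S = ∀ {u v} → u ∈ S → v ∈ S → ¬ (u ~ v)
  where open Graph G

IsIndependenceNumber : Graph → ℕ → Set
IsIndependenceNumber G =
  IsGreatest (λ k → ∃[ S ] (Independent G S × ∣ S ∣ ≡ k))

-- `unoriented` also makes the colour independent of the adjacency proof, so
-- this is a function on the unordered edges.  Colours may remain unused.
record EdgeColouring (G : Graph) (r : ℕ) : Set where
  open Graph G
  field
    colour     : ∀ {u v} → u ~ v → Fin r
    unoriented : ∀ {u v} (e : u ~ v) (f : v ~ u) → colour e ≡ colour f

-- Not necessarily induced.
record Subgraph (G : Graph) : Set₁ where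
  open Graph G
  field
    vertices  : Subset order
    nonempty  : Nonempty vertices
    Edge      : Rel Vertex 0ℓ
    edge?     : Decidable Edge
    edge-sym  : Symmetric Edge
    edge⇒~    : ∀ {u v} → Edge u v → u ~ v
    endpoint  : ∀ {u v} → Edge u v → u ∈ vertices

-- Comparing edges pairwise makes every one-vertex subgraph monochromatic,
-- whatever the number of colours.
Monochromatic : ∀ {G r} → EdgeColouring G r → Subgraph G → Set
Monochromatic χ H =
  ∀ {u v x y} (e : Edge u v) (f : Edge x y) →
  colour (edge⇒~ e) ≡ colour (edge⇒~ f)
  where
  open EdgeColouring χ
  open Subgraph H

data Walk {A : Set} (R : Rel A 0ℓ) : ℕ → A → A → Set where
  []  : ∀ {u} → Walk R zero u u
  _∷_ : ∀ {k u v w} → R u v → Walk R k v w → Walk R (suc k) u w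

module _ {G : Graph} (H : Subgraph G) where
  open Graph G using (Vertex)
  open Subgraph H

  Connected : Set
  Connected = ∀ {u v} → u ∈ vertices → v ∈ vertices → ∃[ k ] Walk Edge k u v

  -- The relation d_H(u,v) = k; no k satisfies it when d_H(u,v) = ∞.
  IsDistance : Vertex → Vertex → ℕ → Set
  IsDistance u v = IsLeast (λ k → Walk Edge k u v)

  DistancesAtMost : ℕ → Set
  DistancesAtMost d =
    ∀ {u v} → u ∈ vertices → v ∈ vertices → ∃[ k ] (IsDistance u v k × k ≤ d)

  IsDiameter : ℕ → Set
  IsDiameter = IsLeast DistancesAtMost

  DiameterAtMost : ℕ → Set
  DiameterAtMost d = ∃[ k ] (IsDiameter k × k ≤ d)

-- The index need not be injective: subgraphs in a cover may repeat.
Covers : ∀ {G k} → (Fin k → Subgraph G) → Set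
Covers {G} H = ∀ (v : Graph.Vertex G) → ∃[ i ] v ∈ Subgraph.vertices (H i)

CoverBound : (r d α k : ℕ) → Set₁
CoverBound r d α k =
  ∀ (G : Graph) → IsIndependenceNumber G α → (χ : EdgeColouring G r) →
  ∃[ H ] (Covers {G} {k} H × (∀ i → Monochromatic χ (H i) × DiameterAtMost (H i) d))

-- The relation g(r,d,α) = k.  A relation rather than a function, since finding
-- the minimum constructively would mean deciding a statement about all graphs.
Isg : (r d α k : ℕ) → Set₁
Isg r d α = IsLeast (CoverBound r d α)

{-# OPTIONS --safe #-}
module Submission where

-- A maximum independent set S dominates G: a vertex outside S with no neighbour
-- in S could be added to it.  So the stars consisting of s ∈ S and its neighbours
-- along one colour cover V(G); there are r α of them, each of diameter at most 2.

open import Data.Fin using (Fin; zero; suc; fromℕ<; combine; remQuot)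
open import Data.Fin.Properties using (_≟_; all?; any?; remQuot-combine)
open import Data.Fin.Subset using (Subset; _∈_; ∣_∣; inside; outside; ⁅_⁆; _∪_)
open import Data.Fin.Subset.Properties
  using (_∈?_; x∈⁅x⁆; x∈⁅y⁆⇒x≡y; p⊆p∪q; q⊆p∪q; x∈p∪q⁻; p⊂q⇒∣p∣<∣q∣)
open import Data.Nat using (ℕ; zero; suc; _*_; _≤_; _<_; _≥_; z≤n; s≤s; s≤s⁻¹)
open import Data.Nat.Properties using (≤-trans; ≤-refl; <⇒≱; anyUpTo?)
open import Data.Product using (_×_; ∃-syntax; _,_; proj₁; proj₂)
open import Data.Sum using (_⊎_; inj₁; inj₂; swap)
open import Data.Vec using ([]; _∷_; tabulate; here; there)
open import Data.Vec.Properties using ([]=⇒lookup; lookup⇒[]=; lookup∘tabulate)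
open import Defs
open import Level using (0ℓ)
open import Relation.Binary using (Rel; Decidable)
open import Relation.Binary.PropositionalEquality using (_≡_; refl; sym; trans; subst)
open import Relation.Nullary using (yes; no; does; contradiction)
open import Relation.Nullary.Decidable
  using (map′; dec-true; _×-dec_; _⊎-dec_; _→-dec_)
import Relation.Unary as Unary

-- Distances and diameters are both least numbers; a known witness `n` bounds the search for them.
-- If `P zero` fails, the least witness of the shifted predicate, plus one, is least for `P`.
boundedLeast : ∀ {ℓ} {P : ℕ → Set ℓ} → Unary.Decidable P → ∀ n → P n →
  ∃[ k ] (IsLeast P k × k ≤ n)
boundedLeast P? zero    p = zero , (p , λ _ _ → z≤n) , z≤n
boundedLeast P? (suc n) p with P? zero
... | yes p₀ = zero , (p₀ , λ _ _ → z≤n) , z≤n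
... | no ¬p₀ with boundedLeast (λ k → P? (suc k)) n p
...   | k , (pk , least) , k≤n =
        suc k
      , (pk , λ { zero p₀ → contradiction p₀ ¬p₀ ; (suc j) pj → s≤s (least j pj) })
      , s≤s k≤n

select : ∀ {n} {P : Fin n → Set} → Unary.Decidable P → Subset n
select P? = tabulate (λ i → does (P? i))

module _ {n} {P : Fin n → Set} (P? : Unary.Decidable P) where

  ∈-select⁺ : ∀ {i} → P i → i ∈ select P?
  ∈-select⁺ {i} p = lookup⇒[]= i _ (trans (lookup∘tabulate _ i) (dec-true (P? i) p))

  ∈-select⁻ : ∀ {i} → i ∈ select P? → P i
  -- Membership says that `does (P? i)` is `inside`; abstracting this equation along with `P? i`
  -- makes the negative case absurd.
  ∈-select⁻ {i} i∈ with P? i | trans (sym (lookup∘tabulate (λ j → does (P? j)) i)) ([]=⇒lookup i∈)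
  ... | yes p | _  = p
  ... | no _  | ()

enumerate : ∀ {n} (S : Subset n) → Fin ∣ S ∣ → Fin n
enumerate (inside  ∷ S) zero    = zero
enumerate (inside  ∷ S) (suc i) = suc (enumerate S i)
enumerate (outside ∷ S) i       = suc (enumerate S i)

enumerate-surjective : ∀ {n} (S : Subset n) {v} → v ∈ S → ∃[ i ] enumerate S i ≡ v
enumerate-surjective (inside  ∷ S) here      = zero , refl
enumerate-surjective (inside  ∷ S) (there p) with enumerate-surjective S p
... | i , refl = suc i , refl
enumerate-surjective (outside ∷ S) (there p) with enumerate-surjective S p
... | i , refl = i , refl

-- With the length fixed, the search is finite: only the second vertex of the walk has to be guessed
-- at each stage.
walk? : ∀ {n} {R : Rel (Fin n) 0ℓ} → Decidable R → ∀ k → Decidable (Walk R k)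
walk? R? zero    u v = map′ (λ { refl → [] }) (λ { [] → refl }) (u ≟ v)
walk? R? (suc k) u v =
  map′ (λ { (w , e , p) → e ∷ p }) (λ { (e ∷ p) → _ , e , p })
    (any? λ w → R? u w ×-dec walk? R? k w v)

module _ {G : Graph} (H : Subgraph G) where
  open Subgraph H

  -- A stand-in for `DistancesAtMost d` that asks for some short walk instead of a shortest one.
  -- Explicit vertices and the strict bound `k < suc d` fit the finite searches `all?` and
  -- `anyUpTo?`.
  JoinedWithin : ℕ → Set
  JoinedWithin d = ∀ u v → u ∈ vertices → v ∈ vertices →
    ∃[ k ] (k < suc d × Walk Edge k u v)

  joinedWithin? : Unary.Decidable JoinedWithin
  joinedWithin? d = all? λ u → all? λ v → (u ∈? vertices) →-dec
    ((v ∈? vertices) →-dec anyUpTo? (λ k → walk? edge? k u v) (suc d))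

  joined⇒distances : ∀ {d} → JoinedWithin d → DistancesAtMost H d
  joined⇒distances joined {u} {v} u∈ v∈ with joined u v u∈ v∈
  ... | k , k<1+d , p with boundedLeast (λ j → walk? edge? j u v) k p
  ...   | j , distance , j≤k = j , distance , ≤-trans j≤k (s≤s⁻¹ k<1+d)

  distances⇒joined : ∀ {d} → DistancesAtMost H d → JoinedWithin d
  distances⇒joined dist u v u∈ v∈ with dist u∈ v∈
  ... | k , (p , _) , k≤d = k , s≤s k≤d , p

  joined⇒connected : ∀ {d} → JoinedWithin d → Connected H
  joined⇒connected joined {u} {v} u∈ v∈ with joined u v u∈ v∈
  ... | k , _ , p = k , p

  -- Being equivalent to `JoinedWithin`, the property `DistancesAtMost H` is decidable; it holds at
  -- `d`, so its least value exists and is at most `d`.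
  joined⇒diameter : ∀ {d} → JoinedWithin d → DiameterAtMost H d
  joined⇒diameter {d} joined =
    boundedLeast (λ k → map′ joined⇒distances distances⇒joined (joinedWithin? k))
      d (joined⇒distances joined)

maximum-dominates : ∀ (G : Graph) (S : Subset (Graph.order G)) → Independent G S →
  (∀ T → Independent G T → ∣ T ∣ ≤ ∣ S ∣) →
  ∀ v → v ∈ S ⊎ ∃[ s ] (s ∈ S × Graph._~_ G s v)
maximum-dominates G S indep maximum v with v ∈? S
... | yes v∈S = inj₁ v∈S
... | no v∉S with any? (λ s → (s ∈? S) ×-dec Graph._~?_ G s v)
...   | yes neighbour = inj₂ neighbour
...   | no isolated   = contradiction (maximum T T-indep) (<⇒≱ larger)
  where
  open Graph G using (_~_; irrefl) renaming (sym to ~-sym)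

  T = S ∪ ⁅ v ⁆

  T-indep : Independent G T
  T-indep {x} {y} x∈T y∈T x~y with x∈p∪q⁻ S ⁅ v ⁆ x∈T | x∈p∪q⁻ S ⁅ v ⁆ y∈T
  ... | inj₁ x∈S | inj₁ y∈S = indep x∈S y∈S x~y
  ... | inj₁ x∈S | inj₂ y∈v = isolated (x , x∈S , subst (x ~_) (x∈⁅y⁆⇒x≡y v y∈v) x~y)
  ... | inj₂ x∈v | inj₁ y∈S = isolated (y , y∈S , subst (y ~_) (x∈⁅y⁆⇒x≡y v x∈v) (~-sym x~y))
  -- Both ends equal `v`, so the edge would be a loop.
  ... | inj₂ x∈v | inj₂ y∈v =
    irrefl (trans (x∈⁅y⁆⇒x≡y v x∈v) (sym (x∈⁅y⁆⇒x≡y v y∈v))) x~y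

  larger : ∣ S ∣ < ∣ T ∣
  larger = p⊂q⇒∣p∣<∣q∣ (p⊆p∪q ⁅ v ⁆ , v , q⊆p∪q S ⁅ v ⁆ (x∈⁅x⁆ v) , v∉S)

module _ {G : Graph} {r : ℕ} (χ : EdgeColouring G r) where
  open Graph G using (Vertex; _~_; _~?_) renaming (sym to ~-sym)
  open EdgeColouring χ

  -- Both colours agree with that of the same reversed edge.
  colour-irrelevant : ∀ {u v} (e f : u ~ v) → colour e ≡ colour f
  colour-irrelevant e f = trans (unoriented e (~-sym e)) (sym (unoriented f (~-sym e)))

  module Star (c : Fin r) (x : Vertex) where

    Leaf : Vertex → Set
    Leaf v = ∃[ e ] colour {x} {v} e ≡ c

    leaf? : Unary.Decidable Leaf
    leaf? v with x ~? v
    ... | no x≁v = no λ { (e , _) → x≁v e }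
    -- Testing the one proof `e` suffices, as any other proof of adjacency carries the same colour.
    ... | yes e  = map′ (e ,_) (λ { (f , eq) → trans (colour-irrelevant e f) eq }) (colour e ≟ c)

    InStar : Vertex → Set
    InStar v = x ≡ v ⊎ Leaf v

    inStar? : Unary.Decidable InStar
    inStar? v = (x ≟ v) ⊎-dec leaf? v

    -- The centre `x` is an end of every edge; edges between leaves are left out even if they have
    -- colour `c`.
    StarEdge : Rel Vertex 0ℓ
    StarEdge u v = (x ≡ u × Leaf v) ⊎ (x ≡ v × Leaf u)

    starEdge⇒~ : ∀ {u v} → StarEdge u v → u ~ v
    starEdge⇒~ (inj₁ (refl , e , _)) = e
    starEdge⇒~ (inj₂ (refl , e , _)) = ~-sym e

    starEdge-colour : ∀ {u v} (e : StarEdge u v) → colour (starEdge⇒~ e) ≡ c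
    starEdge-colour (inj₁ (refl , _ , eq)) = eq
    starEdge-colour (inj₂ (refl , e , eq)) = trans (unoriented (~-sym e) e) eq

    star : Subgraph G
    star = record
      { vertices = select inStar?
      ; nonempty = x , ∈-select⁺ inStar? (inj₁ refl)
      ; Edge     = StarEdge
      ; edge?    = λ u v → ((x ≟ u) ×-dec leaf? v) ⊎-dec ((x ≟ v) ×-dec leaf? u)
      ; edge-sym = swap
      ; edge⇒~   = starEdge⇒~
      ; endpoint = λ { (inj₁ (x≡u , _)) → ∈-select⁺ inStar? (inj₁ x≡u)
                     ; (inj₂ (_ , l))   → ∈-select⁺ inStar? (inj₂ l) }
      }

    star-monochromatic : Monochromatic χ star
    star-monochromatic e f = trans (starEdge-colour e) (sym (starEdge-colour f))

    -- Two leaves are joined through the centre. If they coincide, this walk is not shortest, but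
    -- only an upper bound is needed.
    star-joined : JoinedWithin star 2
    star-joined u v u∈ v∈ with ∈-select⁻ inStar? u∈ | ∈-select⁻ inStar? v∈
    ... | inj₁ refl | inj₁ refl = 0 , s≤s z≤n , []
    ... | inj₁ refl | inj₂ l    = 1 , s≤s (s≤s z≤n) , inj₁ (refl , l) ∷ []
    ... | inj₂ l    | inj₁ refl = 1 , s≤s (s≤s z≤n) , inj₂ (refl , l) ∷ []
    ... | inj₂ l    | inj₂ m    = 2 , ≤-refl , inj₂ (refl , l) ∷ (inj₁ (refl , m) ∷ [])

starCover : ∀ {r} → Fin r → ∀ {α} (G : Graph) → IsIndependenceNumber G α →
  (χ : EdgeColouring G r) →
  ∃[ H ] (Covers {G} {r * α} H ×
    (∀ i → Monochromatic χ (H i) × Connected (H i) × DiameterAtMost (H i) 2))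
starCover {r} c₀ G ((S , indep , refl) , maximum) χ = H , covers , properties
  where
  open Graph G using (Vertex)
  open Star χ

  starAt : Fin r × Fin ∣ S ∣ → Subgraph G
  starAt (c , i) = star c (enumerate S i)

  H : Fin (r * ∣ S ∣) → Subgraph G
  H k = starAt (remQuot ∣ S ∣ k)

  coveredBy : ∀ c {s v} → s ∈ S → v ∈ Subgraph.vertices (star c s) →
    ∃[ k ] v ∈ Subgraph.vertices (H k)
  coveredBy c {v = v} s∈S v∈ with enumerate-surjective S s∈S
  -- `H` decodes an index into a colour and a position in `S`; `combine` is the encoding that
  -- `remQuot` undoes.
  ... | i , refl = combine c i
    , subst (λ p → v ∈ Subgraph.vertices (starAt p)) (sym (remQuot-combine c i)) v∈

  covers : Covers H
  covers v with maximum-dominates G S indep (λ T T-indep → maximum ∣ T ∣ (T , T-indep , refl)) v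
  -- A vertex of `S` is the centre of its own star in every colour, so the default `c₀` will do.
  ... | inj₁ v∈S = coveredBy c₀ v∈S (∈-select⁺ (inStar? c₀ v) (inj₁ refl))
  -- Here the star at `s` is taken in the colour of the edge `e` from `s` to `v`.
  ... | inj₂ (s , s∈S , e) = coveredBy c s∈S (∈-select⁺ (inStar? c s) (inj₂ (e , refl)))
    where c = EdgeColouring.colour χ e

  properties : ∀ k → Monochromatic χ (H k) × Connected (H k) × DiameterAtMost (H k) 2
  properties k =
    let c , i = remQuot ∣ S ∣ k
        joined = star-joined c (enumerate S i)
    in star-monochromatic c (enumerate S i)
     , joined⇒connected (H k) joined
     , joined⇒diameter (H k) joined

mainTheorem4 : ∀ (r α : ℕ) → r ≥ 2 → α ≥ 1 →
    (∀ (G : Graph) → IsIndependenceNumber G α → (χ : EdgeColouring G r) →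
    ∃[ H ] (Covers {G} {r * α} H ×
    (∀ i → Monochromatic χ (H i) × Connected (H i) × DiameterAtMost (H i) 2)))
    × (∀ g → Isg r 2 α g → g ≤ r * α)
-- `r ≥ 2` unfolds to `1 < r`, so `fromℕ<` yields the colour with index 1 as the default. The
-- inequality for `g` is its minimality applied to the bound `r * α`.
mainTheorem4 r α r≥2 _ = cover , λ g isg → proj₂ isg (r * α) bound
  where
  cover = λ G → starCover (fromℕ< r≥2) {α} G

  bound : CoverBound r 2 α (r * α)
  bound G isα χ with cover G isα χ
  ... | H , covers , properties =
    H , covers , λ i → proj₁ (properties i) , proj₂ (proj₂ (properties i))
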